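{- Let $H=(V,E)$ be a hypergraph of rank $3$, and define $g:E\to\mathbb{R}$ by $g(e)=\frac{1}{|e|-1+1/|e|}$ for every edge $e$. Then $g$ is good for $H$.
   Context: A hypergraph $H=(V,E)$ consists of a finite vertex set $V$ and a finite set $E$ of nonempty subsets of $V$ (edges); its rank is the largest size of an edge. For an edge $e$, $N(e)=\{f\in E: f\neq e,\ f\cap e\neq\emptyset\}$. A fractional matching of $H$ is a function $x:E\to[0,1]$ with $\sum_{e\ni v}x(e)\le 1$ for every $v\in V$; it is basic if it is an extreme point of the polytope of fractional matchings of $H$. Given $g:E\to\mathbb{R}$, a basic fractional matching $x$ of $H$ is stuck for $g$ if for every $e\in E$, $\sum_{f\in N(e)}g(f)x(f)>1-g(e)x(e)$. A subgraph of $H$ is a hypergraph $H'=(V,E')$ with $E'\subseteq E$ (neighborhoods and fractional matchings are then taken in $H'$, and $g$ is restricted to $E'$); it is non-empty if $E'\neq\emptyset$. The function $g$ is good for $H$ if no non-empty subgraph of $H$ has a basic fractional matching that is stuck for $g$.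
   Formalization: Fractional matchings take rational rather than real values, and being an extreme point is tested among rational fractional matchings only; since extreme points of this rational polytope are rational, the real claim follows. -}

module Defs where

open import Data.Nat as ℕ using (ℕ; zero; suc)
open import Data.Fin using (Fin; zero; suc; _≟_)
open import Data.Fin.Subset using (Subset; _∈_; _∩_; Nonempty; ∣_∣)
open import Data.Fin.Subset.Properties using (_∈?_; nonempty?)
open import Data.Integer using (+_)
open import Data.Rational using (ℚ; 0ℚ; 1ℚ; ½; _+_; _*_; _-_; _≤_; _<_; _/_)
open import Data.Product using (Σ; ∃; _×_; _,_)
open import Data.Bool using (if_then_else_)
open import Relation.Nullary using (¬_; Dec; does)
open import Relation.Nullary.Decidable using (¬?; _×-dec_)
open import Relation.Binary.PropositionalEquality using (_≡_; _≢_)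
open import Function using (_∘_)
open import Function.Definitions using (Injective)

Σℚ : ∀ {k} → (Fin k → ℚ) → ℚ
Σℚ {zero}  f = 0ℚ
Σℚ {suc k} f = f zero + Σℚ (f ∘ suc)

Σℚ-where : ∀ {k} {P : Fin k → Set} → (∀ i → Dec (P i)) → (Fin k → ℚ) → ℚ
Σℚ-where P? f = Σℚ (λ i → if does (P? i) then f i else 0ℚ)

record Hypergraph (n : ℕ) : Set where
  field
    m         : ℕ
    edge      : Fin m → Subset n
    injective : Injective _≡_ _≡_ edge
    nonempty  : ∀ e → Nonempty (edge e)
open Hypergraph public

HasRank : ∀ {n} → Hypergraph n → ℕ → Set
HasRank H r = (∀ e → ∣ edge H e ∣ ℕ.≤ r) × ∃ λ e → ∣ edge H e ∣ ≡ r

SubgraphOf : ∀ {n} → Hypergraph n → Hypergraph n → Set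
SubgraphOf H' H = ∀ j → ∃ λ i → edge H i ≡ edge H' j

InN : ∀ {n} (H : Hypergraph n) → Fin (m H) → Fin (m H) → Set
InN H e f = (f ≢ e) × Nonempty (edge H f ∩ edge H e)

InN? : ∀ {n} (H : Hypergraph n) (e : Fin (m H)) → ∀ f → Dec (InN H e f)
InN? H e f = ¬? (f ≟ e) ×-dec nonempty? (edge H f ∩ edge H e)

FractionalMatching : ∀ {n} (H : Hypergraph n) → (Fin (m H) → ℚ) → Set
FractionalMatching {n} H x =
  (∀ e → (0ℚ ≤ x e) × (x e ≤ 1ℚ)) ×
  (∀ (v : Fin n) → Σℚ-where (λ e → v ∈? edge H e) x ≤ 1ℚ)

-- Basic = extreme point of the fractional matching polytope:
-- not the midpoint of two distinct fractional matchings.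
Basic : ∀ {n} (H : Hypergraph n) → (Fin (m H) → ℚ) → Set
Basic H x = FractionalMatching H x ×
  ¬ (Σ (Fin (m H) → ℚ) λ y → Σ (Fin (m H) → ℚ) λ z →
       FractionalMatching H y × FractionalMatching H z ×
       (∃ λ e → y e ≢ z e) × (∀ e → x e ≡ ½ * (y e + z e)))

-- g is given as a function of the edge (a subset of V), so that its
-- restriction to any subgraph is automatic.
Stuck : ∀ {n} → (Subset n → ℚ) → (H : Hypergraph n) → (Fin (m H) → ℚ) → Set
Stuck g H x = Basic H x ×
  (∀ e → 1ℚ - g (edge H e) * x e
           < Σℚ-where (InN? H e) (λ f → g (edge H f) * x f))

IsGood : ∀ {n} → (Subset n → ℚ) → Hypergraph n → Set
IsGood {n} g H = ∀ (H' : Hypergraph n) → SubgraphOf H' H → 0 ℕ.< m H' →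
  ∀ (x : Fin (m H') → ℚ) → ¬ Stuck g H' x

-- g(e) = 1 / (|e| - 1 + 1/|e|), written in closed form
-- s / (s² - s + 1) (equal for s ≥ 1; edges are nonempty).
gRank3 : ∀ {n} → Subset n → ℚ
gRank3 e = (+ ∣ e ∣) / suc (∣ e ∣ ℕ.* ∣ e ∣ ℕ.∸ ∣ e ∣)

{-# OPTIONS --safe #-}

-- Let x be a stuck basic fractional matching, p v and q v the x-loads at v of the edges of
-- size 2 and 3, d v the number of support edges of size 2 at v.  Being basic, x has at most
-- as many support edges as tight vertices.  For the opposite strict inequality every support
-- edge e hands out less than 1 to its vertices: an edge of size 2 gives x e + (5/7) q v to v,
-- an edge of size 3 gives c v * x e, where c v = 1, 2/7, 0 for d v = 0, 1, ≥ 2.  As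
-- (5/7) d v + c v ≥ 1, each vertex v receives at least p v + q v, which is 1 if v is tight.
-- That e hands out less than 1 follows from being stuck, which implies 2 x e + (5/7) (q u + q v) < 1
-- for e = uv and 18 x e < 6 + 5 (p u + p v + p w) for e = uvw; size 1 cannot occur.
module Submission where

open import Defs

open import Algebra.Bundles using (module CommutativeRing)
open import Data.Bool using (Bool; true; false; if_then_else_; not; _∧_)
open import Data.Empty using (⊥; ⊥-elim)
open import Data.Fin as Fin using (Fin; zero; suc)
import Data.Fin.Properties as Fin
open import Data.Fin.Subset using (Subset; _∈_) renaming (∣_∣ to card)
open import Data.Fin.Subset.Properties using (_∈?_; x∈p∩q⁻)
open import Data.Integer using (+_)
open import Data.List using (List; []; _∷_; _++_; map; length; foldr)
open import Data.List.Properties using (length-map; map-∘)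
open import Data.List.Relation.Unary.All as All using (All; []; _∷_)
import Data.List.Relation.Unary.All.Properties as All
open import Data.Nat as ℕ using (ℕ; zero; suc)
open import Data.Product using (Σ; ∃; _×_; _,_; proj₁; proj₂)
open import Data.Rational
open import Data.Rational.Properties
open import Data.Rational.Solver using (module +-*-Solver)
open import Data.Sum using (_⊎_; inj₁; inj₂)
open import Data.Vec using ([]; _∷_; here; there)
open import Function using (_∘_)
open import Relation.Binary.PropositionalEquality
open import Relation.Nullary using (¬_; Dec; yes; no; does; contradiction)
open import Relation.Nullary.Decidable using (dec-true; dec-false; decidable-stable; ¬?)
open import Algebra.Properties.Semiring.Sum (CommutativeRing.semiring +-*-commutativeRing)
  using (sum; sum-cong-≗; ∑-distrib-+; ∑-comm; *-distribˡ-sum; *-distribʳ-sum)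
open +-*-Solver using (solve; _:=_; con; _:+_; _:*_; _:-_; :-_)

-- Linear inequalities certified by nonnegative combinations of hypotheses.

-- A linear inequality a < b is proved by exhibiting b - a as a positive combination of the
-- gaps r - l of its hypotheses l < r; the solver then checks the identity.
gap< : ∀ k .{{_ : Positive k}} {a b} → a < b → 0ℚ < k * (b - a)
gap< k {a} {b} a<b = subst (_< k * (b - a)) (*-zeroʳ k)
  (*-monoʳ-<-pos k (subst (_< b - a) (+-inverseʳ a) (+-monoˡ-< (- a) a<b)))

gap≤ : ∀ k .{{_ : NonNegative k}} {a b} → a ≤ b → 0ℚ ≤ k * (b - a)
gap≤ k {a} {b} a≤b = subst (_≤ k * (b - a)) (*-zeroʳ k)
  (*-monoˡ-≤-nonNeg k (subst (_≤ b - a) (+-inverseʳ a) (+-monoˡ-≤ (- a) a≤b)))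

fromGap< : ∀ {a b s} → 0ℚ < s → b ≡ a + s → a < b
fromGap< {a} 0<s refl = subst (_< a + _) (+-identityʳ a) (+-monoʳ-< a 0<s)

fromGap≤ : ∀ {a b s} → 0ℚ ≤ s → b ≡ a + s → a ≤ b
fromGap≤ {a} 0≤s refl = subst (_≤ a + _) (+-identityʳ a) (+-monoʳ-≤ a 0≤s)

infixl 6 _+<_ _+≤_
_+<_ : ∀ {s t} → 0ℚ < s → 0ℚ ≤ t → 0ℚ < s + t
_+<_ = +-mono-<-≤

_+≤_ : ∀ {s t} → 0ℚ ≤ s → 0ℚ ≤ t → 0ℚ ≤ s + t
_+≤_ = +-mono-≤

-- What an edge of size 3 gives away, as linear arithmetic.

-- Class x c p: for a vertex v with p = p v in an edge of size 3 and value x ≤ q v, the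
-- coefficient c = c v with the bound on p v that the d v edges of size 2 at v force.
data Class (x : ℚ) : ℚ → ℚ → Set where
  none : ∀ {p} → p ≤ 0ℚ → Class x 1ℚ p
  one  : ∀ {p} → p ≤ ½ - + 5 / 14 * x → Class x (+ 2 / 7) p
  many : ∀ {p} → p ≤ 1ℚ - x → Class x 0ℚ p

-- The three classes of the third vertex bound `x` by 1/3, 119/277 and 11/23, to be multiplied by
-- the coefficient sums 3, 16/7 and 2. The first product is exactly 1, so there the strictness of
-- the last hypothesis decides; the other two leave 5/277 and 1/23 to spare.
two-none : ∀ {x p₁ p₂ p₃ c} → p₁ ≤ 0ℚ → p₂ ≤ 0ℚ → Class x c p₃ →
  + 18 / 1 * x < + 6 / 1 + + 5 / 1 * (p₁ + p₂ + p₃) → (1ℚ + 1ℚ + c) * x < 1ℚ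
two-none {x} {p₁} {p₂} {p₃} h₁ h₂ (none h₃) h =
  fromGap< (gap< (+ 1 / 6) h +< gap≤ (+ 5 / 6) h₁ +< gap≤ (+ 5 / 6) h₂ +< gap≤ (+ 5 / 6) h₃)
    (solve 4 (λ x p₁ p₂ p₃ → con 1ℚ := (con 1ℚ :+ con 1ℚ :+ con 1ℚ) :* x :+
      (con (+ 1 / 6) :* (con (+ 6 / 1) :+ con (+ 5 / 1) :* (p₁ :+ p₂ :+ p₃) :- con (+ 18 / 1) :* x)
       :+ con (+ 5 / 6) :* (con 0ℚ :- p₁) :+ con (+ 5 / 6) :* (con 0ℚ :- p₂)
       :+ con (+ 5 / 6) :* (con 0ℚ :- p₃))) refl x p₁ p₂ p₃)
two-none {x} {p₁} {p₂} {p₃} h₁ h₂ (one h₃) h =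
  fromGap< (gap< (+ 32 / 277) h +< gap≤ (+ 160 / 277) h₁ +< gap≤ (+ 160 / 277) h₂
            +< gap≤ (+ 160 / 277) h₃ +< positive≤)
    (solve 4 (λ x p₁ p₂ p₃ → con 1ℚ := (con 1ℚ :+ con 1ℚ :+ con (+ 2 / 7)) :* x :+
      (con (+ 32 / 277) :* (con (+ 6 / 1) :+ con (+ 5 / 1) :* (p₁ :+ p₂ :+ p₃) :- con (+ 18 / 1) :* x)
       :+ con (+ 160 / 277) :* (con 0ℚ :- p₁) :+ con (+ 160 / 277) :* (con 0ℚ :- p₂)
       :+ con (+ 160 / 277) :* (con ½ :- con (+ 5 / 14) :* x :- p₃) :+ con (+ 5 / 277))) refl x p₁ p₂ p₃)
  where
  positive≤ : 0ℚ ≤ + 5 / 277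
  positive≤ = nonNegative⁻¹ (+ 5 / 277)
two-none {x} {p₁} {p₂} {p₃} h₁ h₂ (many h₃) h =
  fromGap< (gap< (+ 2 / 23) h +< gap≤ (+ 10 / 23) h₁ +< gap≤ (+ 10 / 23) h₂
            +< gap≤ (+ 10 / 23) h₃ +< positive≤)
    (solve 4 (λ x p₁ p₂ p₃ → con 1ℚ := (con 1ℚ :+ con 1ℚ :+ con 0ℚ) :* x :+
      (con (+ 2 / 23) :* (con (+ 6 / 1) :+ con (+ 5 / 1) :* (p₁ :+ p₂ :+ p₃) :- con (+ 18 / 1) :* x)
       :+ con (+ 10 / 23) :* (con 0ℚ :- p₁) :+ con (+ 10 / 23) :* (con 0ℚ :- p₂)
       :+ con (+ 10 / 23) :* (con 1ℚ :- x :- p₃) :+ con (+ 1 / 23))) refl x p₁ p₂ p₃)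
  where
  positive≤ : 0ℚ ≤ + 1 / 23
  positive≤ = nonNegative⁻¹ (+ 1 / 23)

class⇒c≤1 : ∀ {x c p} → Class x c p → c ≤ 1ℚ
class⇒c≤1 (none _) = ≤-refl
class⇒c≤1 (one _)  = fromGap≤ (nonNegative⁻¹ (+ 5 / 7)) refl
class⇒c≤1 (many _) = nonNegative⁻¹ 1ℚ

none-or-small : ∀ {x c p} → Class x c p → (p ≤ 0ℚ × c ≡ 1ℚ) ⊎ c ≤ + 2 / 7
none-or-small (none h) = inj₁ (h , refl)
none-or-small (one _)  = inj₂ ≤-refl
none-or-small (many _) = inj₂ (nonNegative⁻¹ (+ 2 / 7))

-- Two vertices with coefficient 1 reduce to `two-none`, up to a permutation. Otherwise the
-- coefficients sum to at most 11/7, and bounding each `p` by `1 - x` turns the last hypothesis into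
-- `33 x < 21`.
demand<1 : ∀ {x c₁ c₂ c₃ p₁ p₂ p₃} → 0ℚ ≤ x →
  p₁ ≤ 1ℚ - x → p₂ ≤ 1ℚ - x → p₃ ≤ 1ℚ - x →
  Class x c₁ p₁ → Class x c₂ p₂ → Class x c₃ p₃ →
  + 18 / 1 * x < + 6 / 1 + + 5 / 1 * (p₁ + p₂ + p₃) → (c₁ + c₂ + c₃) * x < 1ℚ
demand<1 {x} {c₁} {c₂} {c₃} {p₁} {p₂} {p₃} 0≤x u₁ u₂ u₃ k₁ k₂ k₃ h =
  go (none-or-small k₁) (none-or-small k₂) (none-or-small k₃)
  where
  -- Enough when at most one coefficient is 1, as then c₁ + c₂ + c₃ ≤ 1 + 2/7 + 2/7.
  11x<7 : + 11 / 7 * x < 1ℚ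
  11x<7 = fromGap<
    (gap< (+ 1 / 21) h +< gap≤ (+ 5 / 21) u₁ +< gap≤ (+ 5 / 21) u₂ +< gap≤ (+ 5 / 21) u₃)
    (solve 4 (λ x p₁ p₂ p₃ → con 1ℚ := con (+ 11 / 7) :* x :+
      (con (+ 1 / 21) :* (con (+ 6 / 1) :+ con (+ 5 / 1) :* (p₁ :+ p₂ :+ p₃) :- con (+ 18 / 1) :* x)
       :+ con (+ 5 / 21) :* (con 1ℚ :- x :- p₁) :+ con (+ 5 / 21) :* (con 1ℚ :- x :- p₂)
       :+ con (+ 5 / 21) :* (con 1ℚ :- x :- p₃))) refl x p₁ p₂ p₃)

  small : c₁ + c₂ + c₃ ≤ + 11 / 7 → (c₁ + c₂ + c₃) * x < 1ℚ
  small c≤ = ≤-<-trans (*-monoʳ-≤-nonNeg x {{nonNegative 0≤x}} c≤) 11x<7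

  go : _ → _ → _ → (c₁ + c₂ + c₃) * x < 1ℚ
  go (inj₁ (h₁ , refl)) (inj₁ (h₂ , refl)) _ = two-none h₁ h₂ k₃ h
  go (inj₁ (h₁ , refl)) (inj₂ s₂) (inj₁ (h₃ , refl)) =
    subst (λ c → c * x < 1ℚ) (solve 2 (λ a b → a :+ a :+ b := a :+ b :+ a) refl 1ℚ c₂)
      (two-none h₁ h₃ k₂ (subst (λ p → + 18 / 1 * x < + 6 / 1 + + 5 / 1 * p)
        (solve 3 (λ a b c → a :+ b :+ c := a :+ c :+ b) refl p₁ p₂ p₃) h))
  go (inj₂ s₁) (inj₁ (h₂ , refl)) (inj₁ (h₃ , refl)) =
    subst (λ c → c * x < 1ℚ) (solve 2 (λ a b → a :+ a :+ b := b :+ a :+ a) refl 1ℚ c₁)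
      (two-none h₂ h₃ k₁ (subst (λ p → + 18 / 1 * x < + 6 / 1 + + 5 / 1 * p)
        (solve 3 (λ a b c → a :+ b :+ c := b :+ c :+ a) refl p₁ p₂ p₃) h))
  go (inj₁ _) (inj₂ s₂) (inj₂ s₃) = small (+-mono-≤ (+-mono-≤ (class⇒c≤1 k₁) s₂) s₃)
  go (inj₂ s₁) (inj₁ _) (inj₂ s₃) = small (+-mono-≤ (+-mono-≤ s₁ (class⇒c≤1 k₂)) s₃)
  go (inj₂ s₁) (inj₂ s₂) _        = small (+-mono-≤ (+-mono-≤ s₁ s₂) (class⇒c≤1 k₃))

-- Indicators and finite sums of rationals.

⟦_⟧ : Bool → ℚ
⟦ b ⟧ = if b then 1ℚ else 0ℚ

0≤⟦⟧ : ∀ b → 0ℚ ≤ ⟦ b ⟧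
0≤⟦⟧ true  = nonNegative⁻¹ 1ℚ
0≤⟦⟧ false = ≤-refl

if-⟦⟧ : ∀ b p → (if b then p else 0ℚ) ≡ ⟦ b ⟧ * p
if-⟦⟧ true  p = sym (*-identityˡ p)
if-⟦⟧ false p = sym (*-zeroˡ p)

*-nonNeg : ∀ {p q} → 0ℚ ≤ p → 0ℚ ≤ q → 0ℚ ≤ p * q
*-nonNeg {p} 0≤p 0≤q = subst₂ _≤_ (*-zeroʳ p) refl (*-monoˡ-≤-nonNeg p {{nonNegative 0≤p}} 0≤q)

-- Moves to the library sum, for which distributivity and interchange of summation are at hand.
Σℚ≡sum : ∀ {k} (f : Fin k → ℚ) → Σℚ f ≡ sum f
Σℚ≡sum {zero}  f = refl
Σℚ≡sum {suc k} f = cong₂ _+_ (refl {x = f zero}) (Σℚ≡sum (f ∘ suc))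

sum-mono-≤ : ∀ {k} {f g : Fin k → ℚ} → (∀ i → f i ≤ g i) → sum f ≤ sum g
sum-mono-≤ {zero}  h = ≤-refl
sum-mono-≤ {suc k} h = +-mono-≤ (h zero) (sum-mono-≤ (h ∘ suc))

sum-mono-< : ∀ {k} {f g : Fin k → ℚ} → (∀ i → f i ≤ g i) → ∀ i → f i < g i → sum f < sum g
sum-mono-< h zero    f<g = +-mono-<-≤ f<g (sum-mono-≤ (h ∘ suc))
sum-mono-< h (suc i) f<g = +-mono-≤-< (h zero) (sum-mono-< (h ∘ suc) i f<g)

sum-zero : ∀ {k} {f : Fin k → ℚ} → (∀ i → f i ≡ 0ℚ) → sum f ≡ 0ℚ
sum-zero {zero}  h = refl
sum-zero {suc k} h = cong₂ _+_ (h zero) (sum-zero (h ∘ suc))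

sum-nonNeg : ∀ {k} {f : Fin k → ℚ} → (∀ i → 0ℚ ≤ f i) → 0ℚ ≤ sum f
sum-nonNeg {zero}  h = ≤-refl
sum-nonNeg {suc k} h = +-mono-≤ (h zero) (sum-nonNeg (h ∘ suc))

term≤sum : ∀ {k} {f : Fin k → ℚ} → (∀ i → 0ℚ ≤ f i) → ∀ i → f i ≤ sum f
term≤sum {f = f} h zero    = subst₂ _≤_ (+-identityʳ (f zero)) refl (+-monoʳ-≤ (f zero) (sum-nonNeg (h ∘ suc)))
term≤sum {f = f} h (suc i) = subst₂ _≤_ (+-identityˡ (f (suc i))) refl (+-mono-≤ (h zero) (term≤sum (h ∘ suc) i))

sum-δ : ∀ {k} (i : Fin k) (f : Fin k → ℚ) → sum (λ j → ⟦ does (i Fin.≟ j) ⟧ * f j) ≡ f i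
sum-δ {suc k} zero f = begin
  1ℚ * f zero + sum (λ j → 0ℚ * f (suc j)) ≡⟨ cong₂ _+_ (*-identityˡ (f zero)) (sum-zero (λ j → *-zeroˡ (f (suc j)))) ⟩
  f zero + 0ℚ                              ≡⟨ +-identityʳ (f zero) ⟩
  f zero                                   ∎
  where open ≡-Reasoning
sum-δ {suc k} (suc i) f = begin
  0ℚ * f zero + _ ≡⟨ cong₂ _+_ (*-zeroˡ (f zero)) (sum-δ i (f ∘ suc)) ⟩
  0ℚ + f (suc i)  ≡⟨ +-identityˡ (f (suc i)) ⟩
  f (suc i)       ∎
  where open ≡-Reasoning

p*q≡0⇒q≡0 : ∀ {p q} .{{_ : NonZero p}} → p * q ≡ 0ℚ → q ≡ 0ℚ
p*q≡0⇒q≡0 {p} {q} h = begin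
  q               ≡⟨ *-identityˡ q ⟨
  1ℚ * q          ≡⟨ cong (_* q) (*-inverseˡ p) ⟨
  1/ p * p * q    ≡⟨ *-assoc (1/ p) p q ⟩
  1/ p * (p * q)  ≡⟨ cong (1/ p *_) h ⟩
  1/ p * 0ℚ       ≡⟨ *-zeroʳ (1/ p) ⟩
  0ℚ              ∎
  where open ≡-Reasoning

-- Nonzero solutions of homogeneous systems with fewer equations than unknowns.

Row : ℕ → Set
Row m = Fin m → ℚ

infix 8 _·_
_·_ : ∀ {m} → Row m → Row m → ℚ
r · d = sum (λ j → r j * d j)

-- The length of a list as a rational, so that it can be compared with sums of indicators.
size : ∀ {A : Set} → List A → ℚ
size []       = 0ℚ
size (_ ∷ as) = 1ℚ + size as

0≤size : ∀ {A : Set} (as : List A) → 0ℚ ≤ size as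
0≤size []       = ≤-refl
0≤size (_ ∷ as) = +-mono-≤ (nonNegative⁻¹ 1ℚ) (0≤size as)

size-map : ∀ {A B : Set} (f : A → B) as → size (map f as) ≡ size as
size-map f []       = refl
size-map f (_ ∷ as) = cong₂ _+_ (refl {x = 1ℚ}) (size-map f as)

size-++ : ∀ {A : Set} (as bs : List A) → size (as ++ bs) ≡ size as + size bs
size-++ []       bs = sym (+-identityˡ _)
size-++ (_ ∷ as) bs = trans (cong₂ _+_ (refl {x = 1ℚ}) (size-++ as bs)) (sym (+-assoc 1ℚ (size as) (size bs)))

-- A row with nonzero first entry, split off from the remaining ones. The field `recover` stands in
-- for a permutation: what holds of `row` and of all of `rest` holds of all of `rows`.
record Pivot {m} (rows : List (Row (suc m))) : Set₁ where
  field
    row     : Row (suc m)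
    rest    : List (Row (suc m))
    row₀≢0  : row zero ≢ 0ℚ
    size≡   : size rows ≡ 1ℚ + size rest
    recover : ∀ {P : Row (suc m) → Set} → P row → All P rest → All P rows

pivot : ∀ {m} (rows : List (Row (suc m))) → All (λ r → r zero ≡ 0ℚ) rows ⊎ Pivot rows
pivot [] = inj₁ []
pivot (r ∷ rows) with r zero ≟ 0ℚ
... | no r₀≢0 = inj₂ record { row = r ; rest = rows ; row₀≢0 = r₀≢0 ; size≡ = refl ; recover = _∷_ }
... | yes r₀≡0 with pivot rows
...   | inj₁ all = inj₁ (r₀≡0 ∷ all)
...   | inj₂ piv = inj₂ record
  { row     = row
  ; rest    = r ∷ rest
  ; row₀≢0  = row₀≢0
  ; size≡   = cong₂ _+_ (refl {x = 1ℚ}) size≡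
  ; recover = λ { p (q ∷ qs) → q ∷ recover p qs }
  }
  where open Pivot piv

-- Gaussian elimination, by induction on the number of unknowns. If the first column vanishes, the
-- first unit vector is a solution. Otherwise a pivot row eliminates the first unknown, which leaves
-- one row and one unknown fewer.
kernel : ∀ m (rows : List (Row m)) → size rows < sum {m} (λ _ → 1ℚ) →
  Σ (Row m) λ d → (∃ λ j → d j ≢ 0ℚ) × All (λ r → r · d ≡ 0ℚ) rows
kernel zero    rows few = contradiction few (≤⇒≯ (0≤size rows))
  where
  ≤⇒≯ : ∀ {p q} → p ≤ q → ¬ q < p
  ≤⇒≯ p≤q q<p = <-irrefl refl (<-≤-trans q<p p≤q)
kernel (suc m) rows few with pivot rows
... | inj₁ all = (λ j → ⟦ does (zero Fin.≟ j) ⟧) , (zero , 1≢0) , All.map (λ {r} → zero-col r) all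
  where
  zero-col : ∀ (r : Row (suc m)) → r zero ≡ 0ℚ → r · (λ j → ⟦ does (zero Fin.≟ j) ⟧) ≡ 0ℚ
  zero-col r r₀≡0 = trans (sum-cong-≗ (λ j → *-comm (r j) ⟦ does (zero Fin.≟ j) ⟧)) (trans (sum-δ zero r) r₀≡0)
... | inj₂ piv = d , (suc (proj₁ nonzero′) , proj₂ nonzero′) , recover row·d≡0 (All.map (λ {r} → reduced r) (All.map⁻ zeros))
  where
  open Pivot piv
  instance
    r₀-nonZero : NonZero (row zero)
    r₀-nonZero = ≢-nonZero row₀≢0
  i₀ = 1/ row zero

  reduce : Row (suc m) → Row m
  -- The multiple of the pivot row is the one that clears the first entry of `r`; only the other
  -- columns are kept.
  reduce r j = r (suc j) + - (r zero * i₀) * row (suc j)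

  few′ : size (map reduce rest) < sum {m} (λ _ → 1ℚ)
  few′ = subst₂ _<_ (sym (size-map reduce rest)) refl
    (+-cancelˡ-< (subst₂ _<_ size≡ refl few))
    where
    +-cancelˡ-< : ∀ {p q} → 1ℚ + p < 1ℚ + q → p < q
    +-cancelˡ-< {p} {q} h = subst₂ _<_ (eq p) (eq q) (+-monoʳ-< (- 1ℚ) h)
      where
      eq : ∀ s → - 1ℚ + (1ℚ + s) ≡ s
      eq s = solve 1 (λ s → con (- 1ℚ) :+ (con 1ℚ :+ s) := s) refl s

  IH = kernel m (map reduce rest) few′
  d′ = proj₁ IH
  nonzero′ = proj₁ (proj₂ IH)
  zeros = proj₂ (proj₂ IH)

  d : Row (suc m)
  -- Back substitution: the pivot equation is solved for the first unknown.
  d zero    = - i₀ * ((row ∘ suc) · d′)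
  d (suc j) = d′ j

  open ≡-Reasoning

  row·d≡0 : row · d ≡ 0ℚ
  row·d≡0 = begin
    row zero * (- i₀ * s) + s ≡⟨ solve 3 (λ r i s → r :* (:- i :* s) :+ s := (con 1ℚ :- r :* i) :* s)
          refl (row zero) i₀ s ⟩
    (1ℚ - row zero * i₀) * s  ≡⟨ cong (λ u → (1ℚ - u) * s) (*-inverseʳ (row zero)) ⟩
    0ℚ * s                    ≡⟨ *-zeroˡ s ⟩
    0ℚ                        ∎
    where s = (row ∘ suc) · d′

  reduced : ∀ r → reduce r · d′ ≡ 0ℚ → r · d ≡ 0ℚ
  reduced r h = begin
    r zero * (- i₀ * s) + (r ∘ suc) · d′
      ≡⟨ solve 4 (λ r i s t → r :* (:- i :* s) :+ t := t :+ :- (r :* i) :* s) refl (r zero) i₀ s ((r ∘ suc) · d′) ⟩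
    (r ∘ suc) · d′ + k * s
      ≡⟨ cong₂ _+_ (refl {x = (r ∘ suc) · d′}) (*-distribˡ-sum k (λ j → row (suc j) * d′ j)) ⟩
    (r ∘ suc) · d′ + sum (λ j → k * (row (suc j) * d′ j))
      ≡⟨ ∑-distrib-+ (λ j → r (suc j) * d′ j) (λ j → k * (row (suc j) * d′ j)) ⟨
    sum (λ j → r (suc j) * d′ j + k * (row (suc j) * d′ j))
      ≡⟨ sum-cong-≗ (λ j → solve 4 (λ a k b d → a :* d :+ k :* (b :* d) := (a :+ k :* b) :* d)
            refl (r (suc j)) k (row (suc j)) (d′ j)) ⟩
    reduce r · d′
      ≡⟨ h ⟩
    0ℚ ∎
    where
    s = (row ∘ suc) · d′
    k = - (r zero * i₀)

-- Selected constraints, and step lengths that respect every slack.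

select : ∀ {k} {A : Set} → (Fin k → Bool) → (Fin k → A) → List A
select {zero}  b f = []
select {suc k} b f = if b zero then f zero ∷ select (b ∘ suc) (f ∘ suc) else select (b ∘ suc) (f ∘ suc)

size-select : ∀ {k} {A : Set} (b : Fin k → Bool) (f : Fin k → A) → size (select b f) ≡ sum (λ i → ⟦ b i ⟧)
size-select {zero}  b f = refl
size-select {suc k} b f with b zero
... | true  = cong₂ _+_ (refl {x = 1ℚ}) (size-select (b ∘ suc) (f ∘ suc))
... | false = trans (size-select (b ∘ suc) (f ∘ suc)) (sym (+-identityˡ _))

select⁻ : ∀ {k} {A : Set} {P : A → Set} (b : Fin k → Bool) (f : Fin k → A) →
  All P (select b f) → ∀ i → b i ≡ true → P (f i)
select⁻ {suc k} b f ps zero bi with b zero | bi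
select⁻ {suc k} b f (p ∷ ps) zero bi | true | _ = p
select⁻ {suc k} b f ps (suc i) bi with b zero
select⁻ {suc k} b f (p ∷ ps) (suc i) bi | true  = select⁻ (b ∘ suc) (f ∘ suc) ps i bi
select⁻ {suc k} b f ps       (suc i) bi | false = select⁻ (b ∘ suc) (f ∘ suc) ps i bi

p≤∣p∣ : ∀ p → p ≤ ∣ p ∣
p≤∣p∣ p with ≤-total 0ℚ p
... | inj₁ 0≤p = ≤-reflexive (sym (0≤p⇒∣p∣≡p 0≤p))
... | inj₂ p≤0 = ≤-trans p≤0 (0≤∣p∣ p)

-- Here `a` is the slack of a constraint and `b` its rate of change: a step of length ε in either
-- direction does not exhaust the slack. A constraint without slack must not change at all, and then
-- any step will do.
safe-step : ∀ {a} b → 0ℚ ≤ a → (a ≡ 0ℚ → b ≡ 0ℚ) → ∃ λ ε → 0ℚ < ε × ε * ∣ b ∣ ≤ a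
safe-step {a} b 0≤a a≡0⇒b≡0 with a ≟ 0ℚ
... | yes a≡0 = 1ℚ , positive⁻¹ 1ℚ , ≤-reflexive (begin
    1ℚ * ∣ b ∣ ≡⟨ *-identityˡ ∣ b ∣ ⟩
    ∣ b ∣      ≡⟨ cong ∣_∣ (a≡0⇒b≡0 a≡0) ⟩
    0ℚ         ≡⟨ a≡0 ⟨
    a          ∎)
  where open ≡-Reasoning
-- Dividing by `1 + ∣ b ∣` instead of `∣ b ∣` also covers `b = 0`.
... | no a≢0 = a * 1/ c , positive⁻¹ (a * 1/ c) , (begin
    a * 1/ c * ∣ b ∣ ≤⟨ *-monoˡ-≤-nonNeg (a * 1/ c) {{pos⇒nonNeg (a * 1/ c)}} (p≤1+p ∣ b ∣) ⟩
    a * 1/ c * c     ≡⟨ *-assoc a (1/ c) c ⟩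
    a * (1/ c * c)   ≡⟨ cong (a *_) (*-inverseˡ c) ⟩
    a * 1ℚ           ≡⟨ *-identityʳ a ⟩
    a                ∎)
  where
  open ≤-Reasoning
  c = 1ℚ + ∣ b ∣
  p≤1+p : ∀ p → p ≤ 1ℚ + p
  p≤1+p p = fromGap≤ (nonNegative⁻¹ 1ℚ) (+-comm 1ℚ p)
  instance
    _ = nonNegative 0≤a
    _ = ≢-nonZero a≢0
    a-pos : Positive a
    a-pos = nonNeg∧nonZero⇒pos a
    _ = ∣-∣-nonNeg b
    c-pos : Positive c
    c-pos = pos+nonNeg⇒pos 1ℚ ∣ b ∣
    c-nonZero : NonZero c
    c-nonZero = pos⇒nonZero c
    1/c-pos : Positive (1/ c)
    1/c-pos = 1/pos⇒pos c
    ε-pos : Positive (a * 1/ c)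
    ε-pos = pos*pos⇒pos a (1/ c)

shrink : ∀ {δ ε a} b → δ ≤ ε → ε * ∣ b ∣ ≤ a → δ * ∣ b ∣ ≤ a
shrink b δ≤ε h = ≤-trans (*-monoʳ-≤-nonNeg ∣ b ∣ {{∣-∣-nonNeg b}} δ≤ε) h

⊓-pos : ∀ {p q} → 0ℚ < p → 0ℚ < q → 0ℚ < p ⊓ q
⊓-pos {p} {q} 0<p 0<q with ⊓-sel p q
... | inj₁ eq = subst (0ℚ <_) (sym eq) 0<p
... | inj₂ eq = subst (0ℚ <_) (sym eq) 0<q

-- The minimum of finitely many positive safe steps is positive and safe for each constraint.
uniform-step : ∀ {k} (a b : Fin k → ℚ) → (∀ i → 0ℚ ≤ a i) → (∀ i → a i ≡ 0ℚ → b i ≡ 0ℚ) →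
  ∃ λ ε → 0ℚ < ε × ∀ i → ε * ∣ b i ∣ ≤ a i
uniform-step {zero}  a b 0≤a h = 1ℚ , positive⁻¹ 1ℚ , λ ()
uniform-step {suc k} a b 0≤a h with safe-step (b zero) (0≤a zero) (h zero)
                                 | uniform-step (a ∘ suc) (b ∘ suc) (0≤a ∘ suc) (h ∘ suc)
... | δ , 0<δ , δ≤ | ε , 0<ε , ε≤ = δ ⊓ ε , ⊓-pos 0<δ 0<ε , λ
  { zero    → shrink (b zero) (p⊓q≤p δ ε) δ≤
  ; (suc i) → shrink (b (suc i)) (p⊓q≤q δ ε) (ε≤ i)
  }

1-p≡0⇒p≡1 : ∀ {p} → 1ℚ - p ≡ 0ℚ → p ≡ 1ℚ
1-p≡0⇒p≡1 {p} h = trans (solve 1 (λ p → p := con 1ℚ :- (con 1ℚ :- p)) refl p) (cong (λ u → 1ℚ - u) h)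

-- Extreme points: support edges against tight vertices.

module _ {n} (H : Hypergraph n) where

  incidence : Fin n → Row (m H)
  incidence v e = ⟦ does (v ∈? edge H e) ⟧

  load≡ : ∀ v x → Σℚ-where (λ e → v ∈? edge H e) x ≡ incidence v · x
  load≡ v x = trans (Σℚ≡sum (λ e → if does (v ∈? edge H e) then x e else 0ℚ))
    (sum-cong-≗ (λ e → if-⟦⟧ (does (v ∈? edge H e)) (x e)))

  incidence-∈ : ∀ {v e} → v ∈ edge H e → incidence v e ≡ 1ℚ
  incidence-∈ {v} {e} v∈e = cong ⟦_⟧ (dec-true (v ∈? edge H e) v∈e)

  single≤load : ∀ {x v e} → (∀ f → 0ℚ ≤ x f) → v ∈ edge H e → x e ≤ incidence v · x
  single≤load {x} {v} {e} 0≤x v∈e = subst₂ _≤_ (trans (cong (_* x e) (incidence-∈ {v} {e} v∈e)) (*-identityˡ (x e))) refl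
    (term≤sum (λ f → *-nonNeg (0≤⟦⟧ (does (v ∈? edge H f))) (0≤x f)) e)

  -- The bound `x e ≤ 1` comes from the load at any vertex of `e`, as edges are nonempty.
  fractional : ∀ {x} → (∀ e → 0ℚ ≤ x e) → (∀ v → incidence v · x ≤ 1ℚ) → FractionalMatching H x
  fractional {x} 0≤x load≤1 = (λ e → 0≤x e , ≤-trans (single≤load 0≤x (proj₂ (nonempty H e))) (load≤1 (proj₁ (nonempty H e))))
    , λ v → subst₂ _≤_ (sym (load≡ v x)) refl (load≤1 v)

  -- Require of a direction `d` that it vanish where `x` does and have load 0 at each tight vertex.
  -- If there are fewer tight vertices than support edges, these are fewer than `m H` equations, so
  -- some nonzero `d` satisfies them. For small ε, `x + ε d` and `x - ε d` are then distinct
  -- fractional matchings with midpoint `x`.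
  support≤tight : ∀ {x} → Basic H x →
    ¬ sum (λ v → ⟦ does (incidence v · x ≟ 1ℚ) ⟧) < sum (λ e → ⟦ not (does (x e ≟ 0ℚ)) ⟧)
  support≤tight {x} ((0≤x≤1 , load≤1) , extreme) fewer = extreme
    ((λ e → x e + ε * d e) , (λ e → x e + (- ε) * d e) , perturbed ε ∣ε∣ , perturbed (- ε) (trans (∣-p∣≡∣p∣ ε) ∣ε∣)
    , (proj₁ nonzero , λ y≡z → proj₂ nonzero (differ y≡z))
    , λ e → midpoint (x e) ε (d e))
    where
    0≤x : ∀ e → 0ℚ ≤ x e
    0≤x e = proj₁ (0≤x≤1 e)
    load≤1′ : ∀ v → incidence v · x ≤ 1ℚ
    load≤1′ v = subst₂ _≤_ (load≡ v x) refl (load≤1 v)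

    t : Fin n → Bool
    t v = does (incidence v · x ≟ 1ℚ)
    z : Fin (m H) → Bool
    z e = does (x e ≟ 0ℚ)
    unit : Fin (m H) → Row (m H)
    unit e f = ⟦ does (e Fin.≟ f) ⟧

    rows : List (Row (m H))
    rows = select t incidence ++ select z unit

    complement : ∀ b → ⟦ not b ⟧ + ⟦ b ⟧ ≡ 1ℚ
    complement true  = refl
    complement false = refl

    few : size rows < sum {m H} (λ _ → 1ℚ)
    -- Adding the number of edges with `x e = 0` to both sides of `fewer` gives the number of rows
    -- on the left and the number of edges on the right.
    few = subst₂ _<_
      (sym (trans (size-++ (select t incidence) (select z unit)) (cong₂ _+_ (size-select t incidence) (size-select z unit))))
      (trans (sym (∑-distrib-+ (λ e → ⟦ not (z e) ⟧) (λ e → ⟦ z e ⟧))) (sum-cong-≗ (λ e → complement (z e))))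
      (+-monoˡ-< (sum (λ e → ⟦ z e ⟧)) fewer)

    ker = kernel (m H) rows few
    d = proj₁ ker
    nonzero = proj₁ (proj₂ ker)

    tight⇒0 : ∀ v → incidence v · x ≡ 1ℚ → incidence v · d ≡ 0ℚ
    tight⇒0 v h = select⁻ t incidence (All.++⁻ˡ (select t incidence) (proj₂ (proj₂ ker))) v (dec-true (incidence v · x ≟ 1ℚ) h)

    zero⇒0 : ∀ e → x e ≡ 0ℚ → d e ≡ 0ℚ
    zero⇒0 e h = trans (sym (sum-δ e d))
      (select⁻ z unit (All.++⁻ʳ (select t incidence) (proj₂ (proj₂ ker))) e (dec-true (x e ≟ 0ℚ) h))

    ε₁ = uniform-step x d 0≤x zero⇒0
    ε₂ = uniform-step (λ v → 1ℚ - incidence v · x) (λ v → incidence v · d)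
      (λ v → subst₂ _≤_ (+-inverseʳ (incidence v · x)) refl (+-monoˡ-≤ (- (incidence v · x)) (load≤1′ v)))
      (λ v h → tight⇒0 v (1-p≡0⇒p≡1 h))
    ε = proj₁ ε₁ ⊓ proj₁ ε₂

    0<ε : 0ℚ < ε
    0<ε = ⊓-pos (proj₁ (proj₂ ε₁)) (proj₁ (proj₂ ε₂))

    ∣ε∣ : ∣ ε ∣ ≡ ε
    ∣ε∣ = 0≤p⇒∣p∣≡p (<⇒≤ 0<ε)

    edge-step : ∀ e → ε * ∣ d e ∣ ≤ x e
    edge-step e = shrink (d e) (p⊓q≤p (proj₁ ε₁) (proj₁ ε₂)) (proj₂ (proj₂ ε₁) e)

    vertex-step : ∀ v → ε * ∣ incidence v · d ∣ ≤ 1ℚ - incidence v · x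
    vertex-step v = shrink (incidence v · d) (p⊓q≤q (proj₁ ε₁) (proj₁ ε₂)) (proj₂ (proj₂ ε₂) v)

    bounded : ∀ {σ a} b → ∣ σ ∣ ≡ ε → ε * ∣ b ∣ ≤ a → σ * b ≤ a
    bounded {σ} b ∣σ∣ h = ≤-trans (p≤∣p∣ (σ * b))
      (subst₂ _≤_ (trans (cong (_* ∣ b ∣) (sym ∣σ∣)) (sym (∣p*q∣≡∣p∣*∣q∣ σ b))) refl h)

    perturbed : ∀ σ → ∣ σ ∣ ≡ ε → FractionalMatching H (λ e → x e + σ * d e)
    perturbed σ ∣σ∣ = fractional
      -- Nonnegativity of `x e + σ * d e` is the upper bound `- σ * d e ≤ x e`, hence the opposite
      -- sign.
      (λ e → fromGap≤ (gap≤ 1ℚ (bounded {σ = - σ} (d e) (trans (∣-p∣≡∣p∣ σ) ∣σ∣) (edge-step e)))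
         (solve 3 (λ x σ d → x :+ σ :* d := con 0ℚ :+ con 1ℚ :* (x :- (:- σ) :* d)) refl (x e) σ (d e)))
      (λ v → fromGap≤ (gap≤ 1ℚ (bounded {σ} (incidence v · d) ∣σ∣ (vertex-step v)))
         (trans (solve 3 (λ X σ D → con 1ℚ := X :+ σ :* D :+ con 1ℚ :* (con 1ℚ :- X :- σ :* D))
               refl (incidence v · x) σ (incidence v · d))
           (cong (λ s → s + 1ℚ * (1ℚ - incidence v · x - σ * incidence v · d)) (sym (·-linear v σ)))))
      where
      ·-linear : ∀ v σ → incidence v · (λ e → x e + σ * d e) ≡ incidence v · x + σ * incidence v · d
      ·-linear v σ = begin
        sum (λ e → incidence v e * (x e + σ * d e))
          ≡⟨ sum-cong-≗ (λ e → solve 4 (λ i x σ d → i :* (x :+ σ :* d) := i :* x :+ σ :* (i :* d))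
                refl (incidence v e) (x e) σ (d e)) ⟩
        sum (λ e → incidence v e * x e + σ * (incidence v e * d e))
          ≡⟨ ∑-distrib-+ (λ e → incidence v e * x e) (λ e → σ * (incidence v e * d e)) ⟩
        incidence v · x + sum (λ e → σ * (incidence v e * d e))
          ≡⟨ cong (λ s → incidence v · x + s) (*-distribˡ-sum σ (λ e → incidence v e * d e)) ⟨
        incidence v · x + σ * incidence v · d ∎
        where open ≡-Reasoning

    midpoint : ∀ x ε d → x ≡ ½ * ((x + ε * d) + (x + (- ε) * d))
    midpoint x ε d = solve 3 (λ x ε d → x := con ½ :* ((x :+ ε :* d) :+ (x :+ (:- ε) :* d))) refl x ε d

    differ : ∀ {e} → x e + ε * d e ≡ x e + (- ε) * d e → d e ≡ 0ℚ
    differ {e} h = p*q≡0⇒q≡0 {ε} {d e} (trans (solve 3 (λ x ε d → ε :* d := con ½ :* ((x :+ ε :* d) :- (x :+ (:- ε) :* d)))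
          refl (x e) ε (d e))
        (trans (cong (λ s → ½ * (s - (x e + (- ε) * d e))) h)
          (solve 1 (λ s → con ½ :* (s :- s) := con 0ℚ) refl (x e + (- ε) * d e))))
      where
      instance
        ε-nonZero : NonZero ε
        ε-nonZero = pos⇒nonZero ε {{positive 0<ε}}

-- Counts, and sums over edges of size at most 3.

sum-linear : ∀ {k} a b (f g : Fin k → ℚ) → sum (λ i → a * f i + b * g i) ≡ a * sum f + b * sum g
sum-linear a b f g = trans (∑-distrib-+ (λ i → a * f i) (λ i → b * g i))
  (sym (cong₂ _+_ (*-distribˡ-sum a f) (*-distribˡ-sum b g)))

⟦∧⟧ : ∀ a b → ⟦ a ∧ b ⟧ ≡ ⟦ a ⟧ * ⟦ b ⟧
⟦∧⟧ true  b = sym (*-identityˡ ⟦ b ⟧)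
⟦∧⟧ false b = sym (*-zeroˡ ⟦ b ⟧)

-- Integrality of a count rules out values strictly between 0, 1 and 2. This is the case distinction
-- behind the coefficients `c v`.
count-cases : ∀ {k} (b : Fin k → Bool) → let N = sum (λ i → ⟦ b i ⟧) in
  N ≡ 0ℚ ⊎ N ≡ 1ℚ ⊎ + 2 / 1 ≤ N
count-cases {zero}  b = inj₁ refl
count-cases {suc k} b with b zero | count-cases (b ∘ suc)
... | false | inj₁ h        = inj₁ (trans (+-identityˡ _) h)
... | false | inj₂ (inj₁ h) = inj₂ (inj₁ (trans (+-identityˡ _) h))
... | false | inj₂ (inj₂ h) = inj₂ (inj₂ (subst₂ _≤_ refl (sym (+-identityˡ (sum (λ i → ⟦ b (suc i) ⟧)))) h))
... | true  | inj₁ h        = inj₂ (inj₁ (cong (λ s → 1ℚ + s) h))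
... | true  | inj₂ (inj₁ h) = inj₂ (inj₂ (≤-reflexive (cong (λ s → 1ℚ + s) (sym h))))
... | true  | inj₂ (inj₂ h) = inj₂ (inj₂ (≤-trans h (fromGap≤ (nonNegative⁻¹ 1ℚ) (+-comm 1ℚ (sum (λ i → ⟦ b (suc i) ⟧))))))

-- Matching on the list once its length is bounded turns a sum over an edge into an explicit sum of
-- at most three terms.
elements : ∀ {n} (e : Subset n) → Σ (List (Fin n)) λ l → length l ≡ card e × All (_∈ e) l ×
  (∀ h → sum (λ v → ⟦ does (v ∈? e) ⟧ * h v) ≡ foldr _+_ 0ℚ (map h l))
elements [] = [] , refl , [] , λ h → refl
elements (b ∷ e) with elements e
... | l , len , all , eq with b
...   | true  = zero ∷ map suc l , cong suc (trans (length-map suc l) len) , here ∷ All.map⁺ (All.map there all)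
  , λ h → cong₂ _+_ (*-identityˡ (h zero)) (trans (eq (h ∘ suc)) (cong (foldr _+_ 0ℚ) (map-∘ l)))
...   | false = map suc l , trans (length-map suc l) len , All.map⁺ (All.map there all)
  , λ h → trans (cong₂ _+_ (*-zeroˡ (h zero)) (trans (eq (h ∘ suc)) (cong (foldr _+_ 0ℚ) (map-∘ l))))
      (+-identityˡ (foldr _+_ 0ℚ (map h (map suc l))))

gRank3-nonNeg : ∀ {n} (e : Subset n) → 0ℚ ≤ gRank3 e
gRank3-nonNeg e = nonNegative⁻¹ (gRank3 e) {{normalize-nonNeg (card e) (suc (card e ℕ.* card e ℕ.∸ card e))}}

gRank3-card : ∀ {n} (e : Subset n) {s} → card e ≡ s → gRank3 e ≡ + s / suc (s ℕ.* s ℕ.∸ s)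
gRank3-card e refl = refl


module _ {n} (H : Hypergraph n) where

  over : Fin (m H) → (Fin n → ℚ) → ℚ
  over e h = sum (λ v → incidence H v e * h v)

  -- The expansion of `over e h` for every `h` also encodes that the listed vertices are distinct:
  -- the indicator of a repeated vertex would be counted twice.
  data Shape (e : Fin (m H)) : Set where
    single : ∀ a → card (edge H e) ≡ 1 → a ∈ edge H e → (∀ h → over e h ≡ h a) → Shape e
    pair   : ∀ a b → card (edge H e) ≡ 2 → a ∈ edge H e → b ∈ edge H e →
             (∀ h → over e h ≡ h a + h b) → Shape e
    triple : ∀ a b c → card (edge H e) ≡ 3 → a ∈ edge H e → b ∈ edge H e → c ∈ edge H e →
             (∀ h → over e h ≡ h a + h b + h c) → Shape e

  shape : ∀ e → card (edge H e) ℕ.≤ 3 → Shape e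
  shape e ≤3 with elements (edge H e)
  -- An empty list would make the sum of 1 over `e` vanish, but a vertex of the nonempty edge
  -- contributes 1.
  ... | [] , len , all , eq = ⊥-elim (0≢1 (eq (λ _ → 1ℚ)))
    where
    v = proj₁ (nonempty H e)
    0≢1 : sum (λ v → incidence H v e * 1ℚ) ≡ 0ℚ → ⊥
    0≢1 h = <-irrefl refl (<-≤-trans (positive⁻¹ 1ℚ) (subst₂ _≤_ (cong (_* 1ℚ) (incidence-∈ H {v} {e} (proj₂ (nonempty H e)))) h
      (term≤sum {f = λ v → incidence H v e * 1ℚ} (λ u → *-nonNeg (0≤⟦⟧ (does (u ∈? edge H e))) (nonNegative⁻¹ 1ℚ)) v)))
  ... | a ∷ [] , len , a∈ ∷ [] , eq = single a (sym len) a∈ λ h → trans (eq h) (+-identityʳ (h a))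
  ... | a ∷ b ∷ [] , len , a∈ ∷ b∈ ∷ [] , eq = pair a b (sym len) a∈ b∈
    λ h → trans (eq h) (cong (λ s → h a + s) (+-identityʳ (h b)))
  ... | a ∷ b ∷ c ∷ [] , len , a∈ ∷ b∈ ∷ c∈ ∷ [] , eq = triple a b c (sym len) a∈ b∈ c∈
    λ h → trans (eq h) (solve 3 (λ a b c → a :+ (b :+ (c :+ con 0ℚ)) := a :+ b :+ c) refl (h a) (h b) (h c))
  ... | _ ∷ _ ∷ _ ∷ _ ∷ _ , len , _ = contradiction (subst (ℕ._≤ 3) (sym len) ≤3) λ { (ℕ.s≤s (ℕ.s≤s (ℕ.s≤s ()))) }

-- Neighbourhood sums against the loads at the vertices of an edge.

1≤⇒self≤ : ∀ {a p} → 0ℚ ≤ p → 1ℚ ≤ a → p ≤ a * p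
1≤⇒self≤ {a} {p} 0≤p 1≤a = subst₂ _≤_ (*-identityˡ p) refl (*-monoʳ-≤-nonNeg p {{nonNegative 0≤p}} 1≤a)

module _ {n} (H : Hypergraph n) where

  private
    I = incidence H

  0≤I : ∀ v e → 0ℚ ≤ I v e
  0≤I v e = 0≤⟦⟧ (does (v ∈? edge H e))

  -- The size of the intersection of `e` and `f`; in particular `common e e` is the size of `e`.
  common : ∀ e f → ℚ
  common e f = over H e (λ v → I v f)

  0≤common : ∀ e f → 0ℚ ≤ common e f
  0≤common e f = sum-nonNeg (λ v → *-nonNeg (0≤I v e) (0≤I v f))

  InN⇒1≤common : ∀ {e f} → InN H e f → 1ℚ ≤ common e f
  InN⇒1≤common {e} {f} (_ , v , v∈) = subst₂ _≤_
    (cong₂ _*_ (incidence-∈ H {v} {e} (proj₂ (x∈p∩q⁻ (edge H f) (edge H e) v∈)))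
               (incidence-∈ H {v} {f} (proj₁ (x∈p∩q⁻ (edge H f) (edge H e) v∈)))) refl
    (term≤sum (λ u → *-nonNeg (0≤I u e) (0≤I u f)) v)

  over-load : ∀ e y → over H e (λ v → I v · y) ≡ sum (λ f → common e f * y f)
  over-load e y = begin
    sum (λ v → I v e * sum (λ f → I v f * y f))
      ≡⟨ sum-cong-≗ (λ v → *-distribˡ-sum (I v e) (λ f → I v f * y f)) ⟩
    sum (λ v → sum (λ f → I v e * (I v f * y f)))
      ≡⟨ ∑-comm (λ v f → I v e * (I v f * y f)) ⟩
    sum (λ f → sum (λ v → I v e * (I v f * y f)))
      ≡⟨ sum-cong-≗ (λ f → sum-cong-≗ (λ v → sym (*-assoc (I v e) (I v f) (y f)))) ⟩
    sum (λ f → sum (λ v → I v e * I v f * y f))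
      ≡⟨ sum-cong-≗ (λ f → *-distribʳ-sum (y f) (λ v → I v e * I v f)) ⟨
    sum (λ f → common e f * y f) ∎
    where open ≡-Reasoning

  -- Summing the loads over the vertices of `e` counts each `f` exactly `common e f` times, so a
  -- neighbour at least once and `e` itself as often as it has vertices.
  neighbours≤over : ∀ e {y} → (∀ f → 0ℚ ≤ y f) →
    sum (λ f → ⟦ does (InN? H e f) ⟧ * y f) + common e e * y e ≤ over H e (λ v → I v · y)
  neighbours≤over e {y} 0≤y = subst₂ _≤_
    (trans (∑-distrib-+ (λ f → ⟦ does (InN? H e f) ⟧ * y f) (λ f → ⟦ does (e Fin.≟ f) ⟧ * (common e e * y f)))
      (cong (λ s → sum (λ f → ⟦ does (InN? H e f) ⟧ * y f) + s) (sum-δ e (λ f → common e e * y f))))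
    (sym (over-load e y))
    (sum-mono-≤ (λ f → termwise f (InN? H e f) (e Fin.≟ f)))
    where
    termwise : ∀ f (f∈N? : Dec (InN H e f)) (e≟f : Dec (e ≡ f)) →
      ⟦ does f∈N? ⟧ * y f + ⟦ does e≟f ⟧ * (common e e * y f) ≤ common e f * y f
    termwise f (yes (f≢e , _)) (yes e≡f)  = contradiction (sym e≡f) f≢e
    termwise f (yes f∈N)       (no _)     = subst₂ _≤_
      (solve 2 (λ g o → g := con 1ℚ :* g :+ con 0ℚ :* (o :* g)) refl (y f) (common e e)) refl
      (1≤⇒self≤ (0≤y f) (InN⇒1≤common f∈N))
    termwise f (no _)          (yes refl) = ≤-reflexive
      (solve 2 (λ g o → con 0ℚ :* g :+ con 1ℚ :* (o :* g) := o :* g) refl (y f) (common e e))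
    termwise f (no _)          (no _)     = subst₂ _≤_
      (solve 2 (λ g o → con 0ℚ := con 0ℚ :* g :+ con 0ℚ :* (o :* g)) refl (y f) (common e e)) refl
      (*-nonNeg (0≤common e f) (0≤y f))

-- What being stuck says about edges of each size.

module _ {n} (H : Hypergraph n) (≤3 : ∀ e → card (edge H e) ℕ.≤ 3)
  {x : Row (m H)} (0≤x : ∀ e → 0ℚ ≤ x e) (load≤1 : ∀ v → incidence H v · x ≤ 1ℚ) where


  private
    I = incidence H

  gx : Row (m H)
  gx e = gRank3 (edge H e) * x e

  0≤gx : ∀ e → 0ℚ ≤ gx e
  0≤gx e = *-nonNeg (gRank3-nonNeg (edge H e)) (0≤x e)

  size2 : Fin (m H) → Bool
  size2 e = does (card (edge H e) ℕ.≟ 2)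

  -- By definition `q` collects all edges of size other than 2; they have size 3 once `not-single`
  -- excludes size 1.
  p q : Fin n → ℚ
  p v = sum (λ e → I v e * (⟦ size2 e ⟧ * x e))
  q v = sum (λ e → I v e * (⟦ not (size2 e) ⟧ * x e))

  0≤q : ∀ v → 0ℚ ≤ q v
  0≤q v = sum-nonNeg (λ e → *-nonNeg (0≤I H v e) (*-nonNeg (0≤⟦⟧ (not (size2 e))) (0≤x e)))

  load≡p+q : ∀ v → I v · x ≡ p v + q v
  load≡p+q v = trans (sum-cong-≗ (λ e → split (size2 e) (I v e) (x e)))
    (∑-distrib-+ (λ e → I v e * (⟦ size2 e ⟧ * x e)) (λ e → I v e * (⟦ not (size2 e) ⟧ * x e)))
    where
    split : ∀ b i x → i * x ≡ i * (⟦ b ⟧ * x) + i * (⟦ not b ⟧ * x)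
    split true  i x = solve 2 (λ i x → i :* x := i :* (con 1ℚ :* x) :+ i :* (con 0ℚ :* x)) refl i x
    split false i x = solve 2 (λ i x → i :* x := i :* (con 0ℚ :* x) :+ i :* (con 1ℚ :* x)) refl i x

  p+q≤1 : ∀ v → p v + q v ≤ 1ℚ
  p+q≤1 v = subst₂ _≤_ (load≡p+q v) refl (load≤1 v)

  p≤1-y : ∀ v {y} → y ≤ q v → p v ≤ 1ℚ - y
  p≤1-y v {y} y≤q = fromGap≤ (gap≤ 1ℚ y≤q +≤ gap≤ 1ℚ (p+q≤1 v))
    (solve 3 (λ y p q → con 1ℚ :- y := p :+ (con 1ℚ :* (q :- y) :+ con 1ℚ :* (con 1ℚ :- (p :+ q)))) refl y (p v) (q v))

  module _ (unsatisfied : ∀ e → 1ℚ - gx e < sum (λ f → ⟦ does (InN? H e f) ⟧ * gx f)) where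

    -- In terms of `s`, the size of `e`: the loads of `gx` at the vertices of `e` sum to more than
    -- `1 + (s - 1) * gx e`.
    unsatisfied-over : ∀ e → 1ℚ - gx e + common H e e * gx e < over H e (λ v → I v · gx)
    unsatisfied-over e = <-≤-trans (+-monoˡ-< (common H e e * gx e) (unsatisfied e)) (neighbours≤over H e 0≤gx)

    gx≡ : ∀ e {s} → card (edge H e) ≡ s → gx e ≡ + s / suc (s ℕ.* s ℕ.∸ s) * x e
    gx≡ e eq = cong (_* x e) (gRank3-card (edge H e) eq)

    gx≤x : ∀ e → gx e ≤ x e
    gx≤x e = go (shape H e (≤3 e))
      where
      go : Shape H e → gx e ≤ x e
      go (single _ eq _ _)         = ≤-reflexive (trans (gx≡ e eq) (*-identityˡ (x e)))
      go (pair _ _ eq _ _ _)     = subst₂ _≤_ (sym (gx≡ e eq)) refl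
        (fromGap≤ (*-nonNeg (nonNegative⁻¹ (+ 1 / 3)) (0≤x e)) (solve 1 (λ x → x := con (+ 2 / 3) :* x :+ con (+ 1 / 3) :* x)
              refl (x e)))
      go (triple _ _ _ eq _ _ _ _) = subst₂ _≤_ (sym (gx≡ e eq)) refl
        (fromGap≤ (*-nonNeg (nonNegative⁻¹ (+ 4 / 7)) (0≤x e)) (solve 1 (λ x → x := con (+ 3 / 7) :* x :+ con (+ 4 / 7) :* x)
              refl (x e)))

    -- For an edge consisting of `a` alone, `unsatisfied-over` says that the load of `gx` at `a`
    -- exceeds 1. As `g` is at most 1, so would the load of `x`.
    not-single : ∀ {e a} → a ∈ edge H e → ¬ (∀ h → over H e h ≡ h a)
    not-single {e} {a} a∈ eq = <-irrefl refl (<-≤-trans 1<load (≤-trans gload≤load (load≤1 a)))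
      where
      gload≤load : I a · gx ≤ I a · x
      gload≤load = sum-mono-≤ (λ f → *-monoˡ-≤-nonNeg (I a f) {{nonNegative (0≤I H a f)}} (gx≤x f))
      1<load : 1ℚ < I a · gx
      1<load = subst₂ _<_
        (trans (cong (λ o → 1ℚ - gx e + o * gx e) (trans (eq (λ v → I v e)) (incidence-∈ H {a} {e} a∈)))
          (solve 1 (λ g → con 1ℚ :- g :+ con 1ℚ :* g := con 1ℚ) refl (gx e)))
        (eq (λ v → I v · gx)) (unsatisfied-over e)

    gload≡ : ∀ v → I v · gx ≡ + 2 / 3 * p v + + 3 / 7 * q v
    gload≡ v = trans (sum-cong-≗ termwise)
      (sum-linear (+ 2 / 3) (+ 3 / 7) (λ e → I v e * (⟦ size2 e ⟧ * x e)) (λ e → I v e * (⟦ not (size2 e) ⟧ * x e)))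
      where
      termwise : ∀ e → I v e * gx e ≡ + 2 / 3 * (I v e * (⟦ size2 e ⟧ * x e)) + + 3 / 7 * (I v e * (⟦ not (size2 e) ⟧ * x e))
      termwise e = go (shape H e (≤3 e))
        where
        go : Shape H e → I v e * gx e ≡ + 2 / 3 * (I v e * (⟦ size2 e ⟧ * x e)) + + 3 / 7 * (I v e * (⟦ not (size2 e) ⟧ * x e))
        go (single _ _ a∈ eq) = contradiction eq (not-single a∈)
        go (pair _ _ eq _ _ _) = trans (cong (I v e *_) (gx≡ e eq))
          (subst (λ b → I v e * (+ 2 / 3 * x e) ≡ + 2 / 3 * (I v e * (⟦ b ⟧ * x e)) + + 3 / 7 * (I v e * (⟦ not b ⟧ * x e)))
            (sym (cong (λ s → does (s ℕ.≟ 2)) eq))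
            (solve 2 (λ i x → i :* (con (+ 2 / 3) :* x) := con (+ 2 / 3) :* (i :* (con 1ℚ :* x)) :+ con (+ 3 / 7) :* (i :* (con 0ℚ :* x)))
                  refl (I v e) (x e)))
        go (triple _ _ _ eq _ _ _ _) = trans (cong (I v e *_) (gx≡ e eq))
          (subst (λ b → I v e * (+ 3 / 7 * x e) ≡ + 2 / 3 * (I v e * (⟦ b ⟧ * x e)) + + 3 / 7 * (I v e * (⟦ not b ⟧ * x e)))
            (sym (cong (λ s → does (s ℕ.≟ 2)) eq))
            (solve 2 (λ i x → i :* (con (+ 3 / 7) :* x) := con (+ 2 / 3) :* (i :* (con 0ℚ :* x)) :+ con (+ 3 / 7) :* (i :* (con 1ℚ :* x)))
                  refl (I v e) (x e)))

    -- Three times `unsatisfied-over`, with `g = 2/3`, reads `3 + 2 x e < 2 (p a + p b) + (9/7) (q a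
    -- + q b)`. Replacing each `p` by its upper bound `1 - q` leaves the factor `9/7 - 2 =
    -- -5/7` at each `q`.
    pair-bound : ∀ {e a b} → card (edge H e) ≡ 2 → a ∈ edge H e → b ∈ edge H e → (∀ h → over H e h ≡ h a + h b) →
      + 2 / 1 * x e + + 5 / 7 * (q a + q b) < 1ℚ
    pair-bound {e} {a} {b} eq a∈ b∈ over≡ = fromGap<
      (gap< (+ 3 / 1) h +< gap≤ (+ 2 / 1) (p+q≤1 a) +< gap≤ (+ 2 / 1) (p+q≤1 b))
      (solve 5 (λ x pa qa pb qb → con 1ℚ := con (+ 2 / 1) :* x :+ con (+ 5 / 7) :* (qa :+ qb) :+
        (con (+ 3 / 1) :* ((con (+ 2 / 3) :* pa :+ con (+ 3 / 7) :* qa) :+ (con (+ 2 / 3) :* pb :+ con (+ 3 / 7) :* qb)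
           :- (con 1ℚ :- con (+ 2 / 3) :* x :+ con (+ 2 / 1) :* (con (+ 2 / 3) :* x)))
         :+ con (+ 2 / 1) :* (con 1ℚ :- (pa :+ qa)) :+ con (+ 2 / 1) :* (con 1ℚ :- (pb :+ qb)))) refl (x e) (p a) (q a) (p b) (q b))
      where
      h : 1ℚ - + 2 / 3 * x e + + 2 / 1 * (+ 2 / 3 * x e) < (+ 2 / 3 * p a + + 3 / 7 * q a) + (+ 2 / 3 * p b + + 3 / 7 * q b)
      h = subst₂ _<_
        (cong₂ (λ g o → 1ℚ - g + o * g) (gx≡ e eq)
          (trans (over≡ (λ v → I v e)) (cong₂ _+_ (incidence-∈ H {a} {e} a∈) (incidence-∈ H {b} {e} b∈))))
        (trans (over≡ (λ v → I v · gx)) (cong₂ _+_ (gload≡ a) (gload≡ b)))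
        (unsatisfied-over e)

    -- As for pairs, now with `g = 3/7` and factor 21, but eliminating `q` through `q ≤ 1 - p`; the
    -- factor `14 - 9 = 5` remains at each `p`.
    triple-bound : ∀ {e a b c} → card (edge H e) ≡ 3 → a ∈ edge H e → b ∈ edge H e → c ∈ edge H e →
      (∀ h → over H e h ≡ h a + h b + h c) →
      + 18 / 1 * x e < + 6 / 1 + + 5 / 1 * (p a + p b + p c)
    triple-bound {e} {a} {b} {c} eq a∈ b∈ c∈ over≡ = fromGap<
      (gap< (+ 21 / 1) h +< gap≤ (+ 9 / 1) (p+q≤1 a) +< gap≤ (+ 9 / 1) (p+q≤1 b) +< gap≤ (+ 9 / 1) (p+q≤1 c))
      (solve 7 (λ x pa qa pb qb pc qc → con (+ 6 / 1) :+ con (+ 5 / 1) :* (pa :+ pb :+ pc) := con (+ 18 / 1) :* x :+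
        (con (+ 21 / 1) :* ((con (+ 2 / 3) :* pa :+ con (+ 3 / 7) :* qa) :+ (con (+ 2 / 3) :* pb :+ con (+ 3 / 7) :* qb)
             :+ (con (+ 2 / 3) :* pc :+ con (+ 3 / 7) :* qc)
           :- (con 1ℚ :- con (+ 3 / 7) :* x :+ con (+ 3 / 1) :* (con (+ 3 / 7) :* x)))
         :+ con (+ 9 / 1) :* (con 1ℚ :- (pa :+ qa)) :+ con (+ 9 / 1) :* (con 1ℚ :- (pb :+ qb)) :+ con (+ 9 / 1) :* (con 1ℚ :- (pc :+ qc))))
        refl (x e) (p a) (q a) (p b) (q b) (p c) (q c))
      where
      h : 1ℚ - + 3 / 7 * x e + + 3 / 1 * (+ 3 / 7 * x e)
          < (+ 2 / 3 * p a + + 3 / 7 * q a) + (+ 2 / 3 * p b + + 3 / 7 * q b) + (+ 2 / 3 * p c + + 3 / 7 * q c)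
      h = subst₂ _<_
        (cong₂ (λ g o → 1ℚ - g + o * g) (gx≡ e eq)
          (trans (over≡ (λ v → I v e))
            (cong₂ _+_ (cong₂ _+_ (incidence-∈ H {a} {e} a∈) (incidence-∈ H {b} {e} b∈)) (incidence-∈ H {c} {e} c∈))))
        (trans (over≡ (λ v → I v · gx)) (cong₂ _+_ (cong₂ _+_ (gload≡ a) (gload≡ b)) (gload≡ c)))
        (unsatisfied-over e)

    -- Discharging: what support edges give and vertices receive.

    supp : Fin (m H) → Bool
    supp e = not (does (x e ≟ 0ℚ))

    supp-false⇒0 : ∀ e → supp e ≡ false → x e ≡ 0ℚ
    supp-false⇒0 e = go (x e ≟ 0ℚ)
      where
      go : (x≟0 : Dec (x e ≡ 0ℚ)) → not (does x≟0) ≡ false → x e ≡ 0ℚ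
      go (yes x≡0) _ = x≡0

    deg₂ : Fin n → ℚ
    deg₂ v = sum (λ e → I v e * (⟦ size2 e ⟧ * ⟦ supp e ⟧))

    deg₂-cases : ∀ v → deg₂ v ≡ 0ℚ ⊎ deg₂ v ≡ 1ℚ ⊎ + 2 / 1 ≤ deg₂ v
    deg₂-cases v = subst (λ N → N ≡ 0ℚ ⊎ N ≡ 1ℚ ⊎ + 2 / 1 ≤ N)
      (sum-cong-≗ (λ e → trans (⟦∧⟧ (does (v ∈? edge H e)) (size2 e ∧ supp e)) (cong (I v e *_) (⟦∧⟧ (size2 e) (supp e)))))
      (count-cases (λ e → does (v ∈? edge H e) ∧ (size2 e ∧ supp e)))

    -- Dropping the `q` of the other endpoint from `pair-bound` gives `x e ≤ 1/2 - (5/14) q v` for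
    -- each edge `e` of size 2 at `v`; only those in the support contribute to `p v`.
    p≤deg₂ : ∀ v → p v ≤ deg₂ v * (½ - + 5 / 14 * q v)
    p≤deg₂ v = subst₂ _≤_ refl (sym (*-distribʳ-sum K (λ e → I v e * (⟦ size2 e ⟧ * ⟦ supp e ⟧))))
      (sum-mono-≤ (λ e → termwise e (v ∈? edge H e) (shape H e (≤3 e)) (supp e) refl))
      where
      K = ½ - + 5 / 14 * q v
      pair≤K : ∀ {e a b} → v ∈ edge H e → (∀ h → over H e h ≡ h a + h b) →
        + 2 / 1 * x e + + 5 / 7 * (q a + q b) < 1ℚ → x e ≤ K
      pair≤K {e} {a} {b} v∈e over≡ h = <⇒≤ (fromGap<
        -- Instead of deciding which endpoint `v` is, `q v` is bounded as one term of the
        -- nonnegative sum `q a + q b`.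
        (gap< ½ h +< gap≤ (+ 5 / 14) (subst₂ _≤_ (single≡ v∈e) (over≡ q) (term≤sum (λ u → *-nonNeg (0≤I H u e) (0≤q u)) v)))
        (solve 4 (λ x qv qa qb → con ½ :- con (+ 5 / 14) :* qv := x :+
           (con ½ :* (con 1ℚ :- (con (+ 2 / 1) :* x :+ con (+ 5 / 7) :* (qa :+ qb))) :+ con (+ 5 / 14) :* (qa :+ qb :- qv)))
           refl (x e) (q v) (q a) (q b)))
        where
        single≡ : v ∈ edge H e → I v e * q v ≡ q v
        single≡ v∈e = trans (cong (_* q v) (incidence-∈ H {v} {e} v∈e)) (*-identityˡ (q v))

      termwise : ∀ e (v∈? : Dec (v ∈ edge H e)) → Shape H e → ∀ s → supp e ≡ s →
        ⟦ does v∈? ⟧ * (⟦ size2 e ⟧ * x e) ≤ ⟦ does v∈? ⟧ * (⟦ size2 e ⟧ * ⟦ s ⟧) * K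
      termwise e (no _) _ s _ = ≤-reflexive
        (solve 4 (λ b x s k → con 0ℚ :* (b :* x) := con 0ℚ :* (b :* s) :* k) refl ⟦ size2 e ⟧ (x e) ⟦ s ⟧ K)
      termwise e (yes _) _ false s≡ = ≤-reflexive (trans (cong (λ x → 1ℚ * (⟦ size2 e ⟧ * x)) (supp-false⇒0 e s≡))
        (solve 2 (λ b k → con 1ℚ :* (b :* con 0ℚ) := con 1ℚ :* (b :* con 0ℚ) :* k) refl ⟦ size2 e ⟧ K))
      termwise e (yes _) (single _ _ a∈ over≡) true _ = contradiction over≡ (not-single a∈)
      termwise e (yes _) (triple _ _ _ eq _ _ _ _) true _ =
        subst (λ b → 1ℚ * (⟦ b ⟧ * x e) ≤ 1ℚ * (⟦ b ⟧ * 1ℚ) * K) (sym (cong (λ s → does (s ℕ.≟ 2)) eq))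
          (≤-reflexive (solve 2 (λ x k → con 1ℚ :* (con 0ℚ :* x) := con 1ℚ :* (con 0ℚ :* con 1ℚ) :* k) refl (x e) K))
      termwise e (yes v∈e) (pair _ _ eq a∈ b∈ over≡) true _ =
        subst (λ b → 1ℚ * (⟦ b ⟧ * x e) ≤ 1ℚ * (⟦ b ⟧ * 1ℚ) * K) (sym (cong (λ s → does (s ℕ.≟ 2)) eq))
          (subst₂ _≤_ (solve 1 (λ x → x := con 1ℚ :* (con 1ℚ :* x)) refl (x e))
            (solve 1 (λ k → k := con 1ℚ :* (con 1ℚ :* con 1ℚ) :* k) refl K)
            (pair≤K v∈e over≡ (pair-bound eq a∈ b∈ over≡)))

    -- The field `covers` ensures that `v` receives enough. The field `class` ranges over all
    -- `y ≤ q v` because it is used with `y = x e` for each edge `e` of size 3 at `v`.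
    record Demand (v : Fin n) : Set where
      field
        c     : ℚ
        covers : 1ℚ ≤ + 5 / 7 * deg₂ v + c
        class : ∀ {y} → y ≤ q v → Class y c (p v)

    -- The coefficient is the least nonnegative one allowed by `covers`. The bound on `p v` comes
    -- from `p≤deg₂` for degree 0 and 1, and from the load constraint for higher degree.
    demand : ∀ v → Demand v
    demand v = go (deg₂-cases v)
      where
      go : _ → Demand v
      go (inj₁ d≡0) = record
        { c = 1ℚ
        ; covers = ≤-reflexive (cong (λ d → + 5 / 7 * d + 1ℚ) (sym d≡0))
        ; class = λ _ → none (subst₂ _≤_ refl (trans (cong (_* (½ - + 5 / 14 * q v)) d≡0) (*-zeroˡ (½ - + 5 / 14 * q v))) (p≤deg₂ v))
        }
      go (inj₂ (inj₁ d≡1)) = record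
        { c = + 2 / 7
        ; covers = ≤-reflexive (cong (λ d → + 5 / 7 * d + + 2 / 7) (sym d≡1))
        ; class = λ {y} y≤q → one (≤-trans (p≤deg₂ v) (subst (λ d → d * (½ - + 5 / 14 * q v) ≤ ½ - + 5 / 14 * y) (sym d≡1)
            (fromGap≤ (gap≤ (+ 5 / 14) y≤q)
              (solve 2 (λ y q → con ½ :- con (+ 5 / 14) :* y := con 1ℚ :* (con ½ :- con (+ 5 / 14) :* q) :+ con (+ 5 / 14) :* (q :- y)) refl y (q v)))))
        }
      go (inj₂ (inj₂ 2≤d)) = record
        { c = 0ℚ
        ; covers = fromGap≤ (gap≤ (+ 5 / 7) 2≤d +≤ nonNegative⁻¹ (+ 3 / 7))
            (solve 1 (λ d → con (+ 5 / 7) :* d :+ con 0ℚ := con 1ℚ :+ (con (+ 5 / 7) :* (d :- con (+ 2 / 1)) :+ con (+ 3 / 7)))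
                  refl (deg₂ v))
        ; class = λ {y} y≤q → many (p≤1-y v y≤q)
        }

    c : Fin n → ℚ
    c v = Demand.c (demand v)

    -- The factor `⟦ supp e ⟧` keeps an edge with `x e = 0` from handing out `(5/7) q v`; the other
    -- terms vanish with `x e`.
    share : Fin (m H) → Fin n → ℚ
    share e v = ⟦ size2 e ⟧ * (x e + + 5 / 7 * (⟦ supp e ⟧ * q v)) + c v * (⟦ not (size2 e) ⟧ * x e)

    share-zero : ∀ e → x e ≡ 0ℚ → over H e (share e) ≡ 0ℚ
    share-zero e x≡0 = sum-zero (λ v → trans
      (cong₂ (λ x s → I v e * (⟦ size2 e ⟧ * (x + + 5 / 7 * (⟦ not s ⟧ * q v)) + c v * (⟦ not (size2 e) ⟧ * x)))
        x≡0 (dec-true (x e ≟ 0ℚ) x≡0))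
      (solve 5 (λ i b q c b′ → i :* (b :* (con 0ℚ :+ con (+ 5 / 7) :* (con 0ℚ :* q)) :+ c :* (b′ :* con 0ℚ)) := con 0ℚ)
        refl (I v e) ⟦ size2 e ⟧ (q v) (c v) ⟦ not (size2 e) ⟧))

    -- For a pair the total is the left side of `pair-bound`; for a triple it is `x e` times the sum
    -- of three coefficients, which `demand<1` bounds.
    share<1 : ∀ e → x e ≢ 0ℚ → over H e (share e) < 1ℚ
    share<1 e x≢0 = go (shape H e (≤3 e))
      where
      share≡ : ∀ {k} → card (edge H e) ≡ k → ∀ v → share e v ≡
        ⟦ does (k ℕ.≟ 2) ⟧ * (x e + + 5 / 7 * (1ℚ * q v)) + c v * (⟦ not (does (k ℕ.≟ 2)) ⟧ * x e)
      share≡ eq v = cong₂ (λ k s → ⟦ does (k ℕ.≟ 2) ⟧ * (x e + + 5 / 7 * (⟦ not s ⟧ * q v)) + c v * (⟦ not (does (k ℕ.≟ 2)) ⟧ * x e))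
        eq (dec-false (x e ≟ 0ℚ) x≢0)

      x≤q : ∀ v → card (edge H e) ≡ 3 → v ∈ edge H e → x e ≤ q v
      x≤q v eq v∈e = subst₂ _≤_
        (trans (cong₂ (λ i k → i * (⟦ not (does (k ℕ.≟ 2)) ⟧ * x e)) (incidence-∈ H {v} {e} v∈e) eq)
          (solve 1 (λ x → con 1ℚ :* (con 1ℚ :* x) := x) refl (x e))) refl
        (term≤sum (λ f → *-nonNeg (0≤I H v f) (*-nonNeg (0≤⟦⟧ (not (size2 f))) (0≤x f))) e)

      go : Shape H e → over H e (share e) < 1ℚ
      go (single _ _ a∈ over≡) = contradiction over≡ (not-single a∈)
      go (pair a b eq a∈ b∈ over≡) = subst₂ _<_
        (sym (trans (over≡ (share e)) (trans (cong₂ _+_ (share≡ eq a) (share≡ eq b))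
          (solve 5 (λ x qa qb ca cb →
            (con 1ℚ :* (x :+ con (+ 5 / 7) :* (con 1ℚ :* qa)) :+ ca :* (con 0ℚ :* x))
            :+ (con 1ℚ :* (x :+ con (+ 5 / 7) :* (con 1ℚ :* qb)) :+ cb :* (con 0ℚ :* x))
            := con (+ 2 / 1) :* x :+ con (+ 5 / 7) :* (qa :+ qb)) refl (x e) (q a) (q b) (c a) (c b))))) refl
        (pair-bound eq a∈ b∈ over≡)
      go (triple a₁ a₂ a₃ eq a₁∈ a₂∈ a₃∈ over≡) = subst₂ _<_
        (sym (trans (over≡ (share e)) (trans (cong₂ _+_ (cong₂ _+_ (share≡ eq a₁) (share≡ eq a₂)) (share≡ eq a₃))
          (solve 7 (λ x q₁ q₂ q₃ c₁ c₂ c₃ →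
            (con 0ℚ :* (x :+ con (+ 5 / 7) :* (con 1ℚ :* q₁)) :+ c₁ :* (con 1ℚ :* x))
            :+ (con 0ℚ :* (x :+ con (+ 5 / 7) :* (con 1ℚ :* q₂)) :+ c₂ :* (con 1ℚ :* x))
            :+ (con 0ℚ :* (x :+ con (+ 5 / 7) :* (con 1ℚ :* q₃)) :+ c₃ :* (con 1ℚ :* x))
            := (c₁ :+ c₂ :+ c₃) :* x) refl (x e) (q a₁) (q a₂) (q a₃) (c a₁) (c a₂) (c a₃))))) refl
        (demand<1 (0≤x e) (p≤1-y a₁ (x≤q a₁ eq a₁∈)) (p≤1-y a₂ (x≤q a₂ eq a₂∈)) (p≤1-y a₃ (x≤q a₃ eq a₃∈))
          (Demand.class (demand a₁) (x≤q a₁ eq a₁∈))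
          (Demand.class (demand a₂) (x≤q a₂ eq a₂∈))
          (Demand.class (demand a₃) (x≤q a₃ eq a₃∈))
          (triple-bound eq a₁∈ a₂∈ a₃∈ over≡))

    share≤supp : ∀ e → over H e (share e) ≤ ⟦ supp e ⟧
    share≤supp e = go (x e ≟ 0ℚ)
      where
      go : (x≟0 : Dec (x e ≡ 0ℚ)) → over H e (share e) ≤ ⟦ not (does x≟0) ⟧
      go (yes x≡0) = ≤-reflexive (share-zero e x≡0)
      go (no x≢0)  = <⇒≤ (share<1 e x≢0)

    -- The shares at `v` add up to `p v + q v * ((5/7) deg₂ v + c v)`, and `covers` makes the last
    -- factor at least 1.
    received : ∀ v → I v · x ≤ sum (λ e → I v e * share e v)
    received v = subst₂ _≤_ (sym (load≡p+q v)) (sym received≡)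
      (fromGap≤ (*-nonNeg (0≤q v) (gap≤ 1ℚ (Demand.covers (demand v))))
        (solve 4 (λ p q d c → p :+ (con (+ 5 / 7) :* q) :* d :+ c :* q :=
          p :+ q :+ q :* (con 1ℚ :* (con (+ 5 / 7) :* d :+ c :- con 1ℚ))) refl (p v) (q v) (deg₂ v) (c v)))
      where
      P Q D : Row (m H)
      P e = I v e * (⟦ size2 e ⟧ * x e)
      Q e = I v e * (⟦ not (size2 e) ⟧ * x e)
      D e = I v e * (⟦ size2 e ⟧ * ⟦ supp e ⟧)
      received≡ : sum (λ e → I v e * share e v) ≡ p v + (+ 5 / 7 * q v) * deg₂ v + c v * q v
      received≡ = begin
        sum (λ e → I v e * share e v)
          ≡⟨ sum-cong-≗ (λ e → solve 7 (λ i b x s q c b′ →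
               i :* (b :* (x :+ con (+ 5 / 7) :* (s :* q)) :+ c :* (b′ :* x)) :=
               i :* (b :* x) :+ ((con (+ 5 / 7) :* q) :* (i :* (b :* s)) :+ c :* (i :* (b′ :* x))))
               refl (I v e) ⟦ size2 e ⟧ (x e) ⟦ supp e ⟧ (q v) (c v) ⟦ not (size2 e) ⟧) ⟩
        sum (λ e → P e + ((+ 5 / 7 * q v) * D e + c v * Q e))
          ≡⟨ ∑-distrib-+ P (λ e → (+ 5 / 7 * q v) * D e + c v * Q e) ⟩
        p v + sum (λ e → (+ 5 / 7 * q v) * D e + c v * Q e)
          ≡⟨ cong (λ s → p v + s) (sum-linear (+ 5 / 7 * q v) (c v) D Q) ⟩
        p v + ((+ 5 / 7 * q v) * deg₂ v + c v * q v)
          ≡⟨ +-assoc (p v) ((+ 5 / 7 * q v) * deg₂ v) (c v * q v) ⟨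
        p v + (+ 5 / 7 * q v) * deg₂ v + c v * q v ∎
        where open ≡-Reasoning

    0≤load : ∀ v → 0ℚ ≤ I v · x
    0≤load v = sum-nonNeg (λ e → *-nonNeg (0≤I H v e) (0≤x e))

    tight≤load : ∀ v → ⟦ does (I v · x ≟ 1ℚ) ⟧ ≤ I v · x
    tight≤load v = go (I v · x ≟ 1ℚ)
      where
      go : (l≟1 : Dec (I v · x ≡ 1ℚ)) → ⟦ does l≟1 ⟧ ≤ I v · x
      go (yes l≡1) = ≤-reflexive (sym l≡1)
      go (no _)    = 0≤load v

    -- Provides the edge at which the final count is strict. If `x` vanished, the inequality at `e₀`
    -- would say `1 < 0`.
    positive-edge : Fin (m H) → ∃ λ e → x e ≢ 0ℚ
    positive-edge e₀ = go (Fin.any? (λ e → ¬? (x e ≟ 0ℚ)))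
      where
      go : Dec (∃ λ e → x e ≢ 0ℚ) → ∃ λ e → x e ≢ 0ℚ
      go (yes ∃e) = ∃e
      go (no ∄e)  = contradiction (unsatisfied e₀) λ h → <-irrefl refl (<-trans (positive⁻¹ 1ℚ) (subst₂ _<_
          (cong (λ g → 1ℚ - g) (gx≡0 e₀))
          (sum-zero (λ f → trans (cong (⟦ does (InN? H e₀ f) ⟧ *_) (gx≡0 f)) (*-zeroʳ ⟦ does (InN? H e₀ f) ⟧))) h))
        where
        gx≡0 : ∀ e → gx e ≡ 0ℚ
        gx≡0 e = trans (cong (gRank3 (edge H e) *_) (decidable-stable (x e ≟ 0ℚ) (λ x≢0 → ∄e (e , x≢0))))
          (*-zeroʳ (gRank3 (edge H e)))

    -- Double counting of the shares: summed by vertices they pay 1 to each tight vertex, summed by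
    -- edges they cost less than 1 per support edge.
    tight<support : Fin (m H) → sum (λ v → ⟦ does (I v · x ≟ 1ℚ) ⟧) < sum (λ e → ⟦ not (does (x e ≟ 0ℚ)) ⟧)
    tight<support e₀ = begin-strict
      sum (λ v → ⟦ does (I v · x ≟ 1ℚ) ⟧)          ≤⟨ sum-mono-≤ tight≤load ⟩
      sum (λ v → I v · x)                          ≤⟨ sum-mono-≤ received ⟩
      sum (λ v → sum (λ e → I v e * share e v))    ≡⟨ ∑-comm (λ v e → I v e * share e v) ⟩
      sum (λ e → over H e (share e))               <⟨ sum-mono-< share≤supp (proj₁ e₊) share<supp ⟩
      sum (λ e → ⟦ supp e ⟧)                       ∎
      where
      open ≤-Reasoning
      e₊ = positive-edge e₀
      share<supp : over H (proj₁ e₊) (share (proj₁ e₊)) < ⟦ supp (proj₁ e₊) ⟧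
      share<supp = subst₂ _<_ refl (cong (λ s → ⟦ not s ⟧) (sym (dec-false (x (proj₁ e₊) ≟ 0ℚ) (proj₂ e₊))))
        (share<1 (proj₁ e₊) (proj₂ e₊))

-- The two opposite counts for a subgraph.

theorem9 : ∀ {n} (H : Hypergraph n) → HasRank H 3 → IsGood gRank3 H
theorem9 H (≤3 , _) H′ sub 0<m x (basic@((0≤x≤1 , load≤1) , _) , unsatisfied) =
  -- Everything takes place in `H′`, whose edges have size at most 3 because they are edges of `H`;
  -- `0<m` supplies the starting edge.
  support≤tight H′ basic (tight<support H′
    (λ e → subst (λ s → card s ℕ.≤ 3) (proj₂ (sub e)) (≤3 (proj₁ (sub e))))
    (λ e → proj₁ (0≤x≤1 e))
    (λ v → subst₂ _≤_ (load≡ H′ v x) refl (load≤1 v))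
    (λ e → subst₂ _<_ refl (neighbours≡ e) (unsatisfied e))
    (Fin.fromℕ< 0<m))
  where
  gx′ : Row (m H′)
  gx′ f = gRank3 (edge H′ f) * x f
  neighbours≡ : ∀ e → Σℚ-where (InN? H′ e) gx′ ≡ sum (λ f → ⟦ does (InN? H′ e f) ⟧ * gx′ f)
  neighbours≡ e = trans (Σℚ≡sum (λ f → if does (InN? H′ e f) then gx′ f else 0ℚ))
    (sum-cong-≗ (λ f → if-⟦⟧ (does (InN? H′ e f)) (gx′ f)))
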